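{- Let $G$ be a directed acyclic graph, $s$ a vertex of $G$, and $T_s$ a depth-first search arborescence of $G$ rooted at $s$. Let $s_1$ be a child of $s$ in $T_s$, let $z$ and $u$ belong to $T_{s_1}$, and let $z$ be a proper ancestor of $u$ in $T_s$, i.e., $z = LCA_{T_s}(z,u)$ and $z\neq u$. Then $s\in J(z,u)$ if and only if $s\in J(z,t)$ for some $t\in\delta_G^-(u)$.
   Context: All paths are directed, and a single vertex counts as a (trivial) directed path. For distinct vertices $u,v$ of $G$, a vertex $s$ is a junction of $u,v$ if there are internally disjoint directed paths $P$ from $s$ to $u$ and $Q$ from $s$ to $v$ in $G$, where internally disjoint means that $s$ is the only vertex common to $P$ and $Q$. $J(u,v)=J(v,u)$ is the set of junctions of $u,v$ in $G$, and $J(u,u)=\emptyset$ by convention. In particular, a proper ancestor $u$ of $v$ lies in $J(u,v)$. $\delta_G^-(u)$ is the set of parents (in-neighbours) of $u$ in $G$, i.e. vertices $t$ with an arc from $t$ to $u$. The arborescence $T_s$ is the rooted directed tree built by a depth-first search of $G$ started at $s$; its vertices are $s$ and all descendants of $s$ in $G$, and its arcs are the tree arcs of the search. For $u\in T_s$, $T_u$ is the subarborescence of $T_s$ rooted at $u$ (consisting of $u$ and all its descendants in $T_s$). $LCA_{T_s}(u,v)$ is the unique lowest common ancestor of $u$ and $v$ in the rooted tree $T_s$ (it equals $u$ if $u$ is an ancestor of $v$ in $T_s$). -}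

module Defs where

open import Level using (0ℓ)
open import Data.Nat.Base using (ℕ)
open import Data.Fin.Base using (Fin)
open import Data.List.Base using (List; []; _∷_; [_]; _++_)
open import Data.List.Membership.Propositional using (_∈_; _∉_)
open import Data.List.Relation.Unary.Unique.Propositional using (Unique)
open import Data.Product.Base using (Σ-syntax; _×_; _,_)
open import Relation.Nullary.Negation.Core using (¬_)
open import Relation.Unary using (Pred)
open import Relation.Binary.Core using (Rel)
open import Relation.Binary.Definitions using (Decidable)
open import Relation.Binary.PropositionalEquality.Core using (_≡_; _≢_)
open import Relation.Binary.Construct.Closure.ReflexiveTransitive using (Star; ε; _◅_)
open import Relation.Binary.Construct.Closure.Transitive using (TransClosure)

-- Decidability of the arc relation is what a finite graph gives classically.
record Digraph (n : ℕ) : Set₁ where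
  field
    Arc  : Rel (Fin n) 0ℓ
    arc? : Decidable Arc

open Digraph public

Acyclic : ∀ {n} → Digraph n → Set
Acyclic G = ∀ v → ¬ TransClosure (Arc G) v v

δ⁻ : ∀ {n} → Digraph n → Fin n → Pred (Fin n) 0ℓ
δ⁻ G u t = Arc G t u

------------------------------------------------------------------------
-- Paths and junctions

walkVertices : ∀ {n} (G : Digraph n) {x y} → Star (Arc G) x y → List (Fin n)
walkVertices G {x} ε       = [ x ]
walkVertices G {x} (_ ◅ w) = x ∷ walkVertices G w

record Path {n} (G : Digraph n) (x y : Fin n) : Set where
  constructor path
  field
    walk   : Star (Arc G) x y
    simple : Unique (walkVertices G walk)

  vertices : List (Fin n)
  vertices = walkVertices G walk

InternallyDisjoint : ∀ {n} {G : Digraph n} {s u v} → Path G s u → Path G s v → Set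
InternallyDisjoint {s = s} P Q =
  ∀ x → x ∈ Path.vertices P → x ∈ Path.vertices Q → x ≡ s

-- The conjunct u ≢ v implements the convention J(u,u) = ∅.
J : ∀ {n} → Digraph n → Fin n → Fin n → Pred (Fin n) 0ℓ
J G u v s =
  u ≢ v × (Σ[ P ∈ Path G s u ] Σ[ Q ∈ Path G s v ] InternallyDisjoint P Q)

------------------------------------------------------------------------
-- Depth-first search

-- Visit G S v A S′: a depth-first visit of v, started when the vertices in S
-- have been discovered, can end with the vertices in S′ discovered and with
-- A as the list of its tree arcs.  Explore G S v A S′ is the same for the
-- remaining part of the visit of an already discovered vertex v.  The order
-- in which the arcs leaving v are inspected is arbitrary.
mutual
  data Visit {n} (G : Digraph n) (S : List (Fin n)) (v : Fin n) :
             List (Fin n × Fin n) → List (Fin n) → Set where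
    discover : ∀ {A S′} → Explore G (v ∷ S) v A S′ → Visit G S v A S′

  data Explore {n} (G : Digraph n) (S : List (Fin n)) (v : Fin n) :
               List (Fin n × Fin n) → List (Fin n) → Set where
    finish  : (∀ w → Arc G v w → w ∈ S) → Explore G S v [] S
    advance : ∀ {w A B S′ S″} → Arc G v w → w ∉ S →
              Visit G S w A S′ → Explore G S′ v B S″ →
              Explore G S v ((v , w) ∷ A ++ B) S″

record DFSArborescence {n} (G : Digraph n) (s : Fin n) : Set where
  field
    treeVertices : List (Fin n)
    treeArcs     : List (Fin n × Fin n)
    isSearch     : Visit G [] s treeArcs treeVertices

open DFSArborescence public

module _ {n} {G : Digraph n} {s : Fin n} (T : DFSArborescence G s) where

  Child : Rel (Fin n) 0ℓ
  Child x y = (x , y) ∈ treeArcs T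

  Ancestor : Rel (Fin n) 0ℓ
  Ancestor x y = x ∈ treeVertices T × y ∈ treeVertices T × Star Child x y

  -- The vertex set of the subarborescence rooted at r.
  Sub : Fin n → Pred (Fin n) 0ℓ
  Sub r x = Ancestor r x

  record IsLCA (w u v : Fin n) : Set where
    field
      ancestorˡ : Ancestor w u
      ancestorʳ : Ancestor w v
      lowest    : ∀ x → Ancestor x u → Ancestor x v → Ancestor x w

{-# OPTIONS --safe #-}
module Submission where

-- In an acyclic digraph every walk is a path, so only the disjointness of the
-- two branches of a junction matters.  Tree arcs are arcs of G, hence
-- s →⁺ z →⁺ u in G, and in particular z ≢ s and u ≢ s by acyclicity.
--
-- For the forward direction, the path Q from s to u is nontrivial; let t be its
-- penultimate vertex.  Deleting u from Q leaves a path to t that still meets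
-- the path P to z only in s.  Moreover t ≢ z, since otherwise z would lie on both P and Q
-- and be equal to s.
--
-- Conversely, append the arc (t , u) to the path to t.  The only new vertex is
-- u, and it is not on P: otherwise u would reach z, closing a cycle with the
-- tree path from z to u.
--
-- Of the search itself, only the inclusion of its tree arcs among the arcs of G
-- (Child⇒Arc) plays a role.

open import Defs
open import Data.Nat.Base using (ℕ)
open import Data.Fin.Base using (Fin)
open import Data.Product.Base using (∃; _×_)
open import Function.Bundles using (_⇔_)
open import Relation.Unary using (_∈_)
open import Relation.Binary.PropositionalEquality.Core using (_≢_)

open import Data.Empty using (⊥-elim)
open import Data.List.Membership.Propositional.Properties using (∈-++⁻)
open import Data.List.Membership.Propositional using () renaming (_∈_ to _∈ₗ_)
import Data.List.Relation.Unary.All as All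
open import Data.List.Relation.Unary.AllPairs using ([]; _∷_)
open import Data.List.Relation.Unary.Any using (here; there)
open import Data.List.Relation.Unary.Unique.Propositional using (Unique)
open import Data.Product.Base using (_,_; Σ-syntax)
open import Data.Sum.Base using (_⊎_; inj₁; inj₂)
open import Function.Bundles using (mk⇔)
open import Relation.Binary.Construct.Closure.ReflexiveTransitive
  using (Star; ε; _◅_; _◅◅_; map)
open import Relation.Binary.Construct.Closure.Transitive
  using (TransClosure; [_]; _∷_)
open import Relation.Binary.PropositionalEquality.Core using (_≡_; refl)

module _ {n} (G : Digraph n) where

  arc◅walk⇒⁺ : ∀ {x y z} → Arc G x y → Star (Arc G) y z → TransClosure (Arc G) x z
  arc◅walk⇒⁺ a ε       = [ a ]
  arc◅walk⇒⁺ a (b ◅ w) = a ∷ arc◅walk⇒⁺ b w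

  target∈walk : ∀ {x y} (w : Star (Arc G) x y) → y ∈ₗ walkVertices G w
  target∈walk ε       = here refl
  target∈walk (_ ◅ w) = there (target∈walk w)

  prefix : ∀ {x y v} (w : Star (Arc G) x y) → v ∈ₗ walkVertices G w → Star (Arc G) x v
  prefix ε       (here refl) = ε
  prefix (_ ◅ _) (here refl) = ε
  prefix (a ◅ w) (there v∈w) = a ◅ prefix w v∈w

  suffix : ∀ {x y v} (w : Star (Arc G) x y) → v ∈ₗ walkVertices G w → Star (Arc G) v y
  suffix ε       (here refl) = ε
  suffix (a ◅ w) (here refl) = a ◅ w
  suffix (_ ◅ w) (there v∈w) = suffix w v∈w

  ∈-snoc⁻ : ∀ {x t u v} (w : Star (Arc G) x t) (a : Arc G t u) →
            v ∈ₗ walkVertices G (w ◅◅ a ◅ ε) → v ∈ₗ walkVertices G w ⊎ v ≡ u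
  ∈-snoc⁻ ε       a (here refl)         = inj₁ (here refl)
  ∈-snoc⁻ ε       a (there (here refl)) = inj₂ refl
  ∈-snoc⁻ (_ ◅ w) a (here refl)         = inj₁ (here refl)
  ∈-snoc⁻ (_ ◅ w) a (there v∈wa) with ∈-snoc⁻ w a v∈wa
  ... | inj₁ v∈w = inj₁ (there v∈w)
  ... | inj₂ v≡u = inj₂ v≡u

  -- A nontrivial walk, given by its first arc and the rest, has a last arc;
  -- the walk before that arc visits no further vertices.
  unsnoc : ∀ {x y u} (a : Arc G x y) (w : Star (Arc G) y u) →
           Σ[ t ∈ Fin n ] Arc G t u × (Σ[ w′ ∈ Star (Arc G) x t ]
             (∀ {v} → v ∈ₗ walkVertices G w′ → v ∈ₗ walkVertices G (a ◅ w)))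
  unsnoc a ε = _ , a , ε , λ { (here refl) → here refl }
  unsnoc a (b ◅ w) with unsnoc b w
  ... | t , c , w′ , w′⊆w = t , c , a ◅ w′ , λ where
    (here refl)  → here refl
    (there v∈w′) → there (w′⊆w v∈w′)

  module _ (acyclic : Acyclic G) where

    acyclic⇒antisym : ∀ {x y} → Star (Arc G) x y → Star (Arc G) y x → x ≡ y
    acyclic⇒antisym ε       _  = refl
    acyclic⇒antisym (a ◅ w) w′ = ⊥-elim (acyclic _ (arc◅walk⇒⁺ a (w ◅◅ w′)))

    acyclic⇒path : ∀ {x y} → Star (Arc G) x y → Path G x y
    acyclic⇒path w = path w (unique w)
      where
      unique : ∀ {x y} (w : Star (Arc G) x y) → Unique (walkVertices G w)
      unique ε       = All.[] ∷ []
      unique (a ◅ w) =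
        All.tabulate (λ { v∈w refl → acyclic _ (arc◅walk⇒⁺ a (prefix w v∈w)) }) ∷ unique w

    -- The last arc of the branch to u leaves a vertex t that still has s as a
    -- junction with z.
    junction⇒parent-junction : ∀ {s z u} → z ≢ s → u ≢ s → s ∈ J G z u →
                               ∃ λ t → t ∈ δ⁻ G u × s ∈ J G z t
    junction⇒parent-junction z≢s u≢s (_ , P , path ε _ , _) = ⊥-elim (u≢s refl)
    junction⇒parent-junction {s} {z} z≢s u≢s (_ , P , path (a ◅ w) _ , disjoint)
      with unsnoc a w
    ... | t , t→u , w′ , w′⊆aw =
      t , t→u , z≢t , P , acyclic⇒path w′ , λ x x∈P x∈w′ → disjoint x x∈P (w′⊆aw x∈w′)
      where
      z≢t : z ≢ t
      z≢t refl = z≢s (disjoint z (target∈walk (Path.walk P)) (w′⊆aw (target∈walk w′)))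

    parent-junction⇒junction : ∀ {s z t u} → z ≢ u → Star (Arc G) z u →
                               Arc G t u → s ∈ J G z t → s ∈ J G z u
    parent-junction⇒junction {s} {z} {t} {u} z≢u z→*u t→u (_ , P , Q , disjoint) =
      z≢u , P , acyclic⇒path (Path.walk Q ◅◅ t→u ◅ ε) , disjoint′
      where
      disjoint′ : ∀ x → x ∈ₗ Path.vertices P →
                  x ∈ₗ walkVertices G (Path.walk Q ◅◅ t→u ◅ ε) → x ≡ s
      disjoint′ x x∈P x∈Qu with ∈-snoc⁻ (Path.walk Q) t→u x∈Qu
      ... | inj₁ x∈Q  = disjoint x x∈P x∈Q
      -- If u were on P, then u would reach z.
      ... | inj₂ refl = ⊥-elim (z≢u (acyclic⇒antisym z→*u (suffix (Path.walk P) x∈P)))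

module _ {n} {G : Digraph n} where

  mutual
    visit-arcs : ∀ {S v A S′ x y} → Visit G S v A S′ → (x , y) ∈ₗ A → Arc G x y
    visit-arcs (discover e) = explore-arcs e

    explore-arcs : ∀ {S v A S′ x y} → Explore G S v A S′ → (x , y) ∈ₗ A → Arc G x y
    explore-arcs (advance a _ _ _) (here refl) = a
    explore-arcs (advance {A = A} _ _ vis e) (there xy∈) with ∈-++⁻ A xy∈
    ... | inj₁ xy∈A = visit-arcs vis xy∈A
    ... | inj₂ xy∈B = explore-arcs e xy∈B

  Child⇒Arc : ∀ {s} (T : DFSArborescence G s) {x y} → Child T x y → Arc G x y
  Child⇒Arc T = visit-arcs (isSearch T)

  -- A vertex of the subarborescence rooted at a child of s is a proper
  -- descendant of s.
  Sub-child⇒≢ : Acyclic G → ∀ {s s₁} (T : DFSArborescence G s) → Child T s s₁ →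
                ∀ {x} → x ∈ Sub T s₁ → x ≢ s
  Sub-child⇒≢ acyclic T s→s₁ (_ , _ , s₁→*x) refl =
    acyclic _ (arc◅walk⇒⁺ G (Child⇒Arc T s→s₁) (map (Child⇒Arc T) s₁→*x))

lemma3 : ∀ (n : ℕ) (G : Digraph n) → Acyclic G →
    (s : Fin n) (T : DFSArborescence G s) →
    (s₁ : Fin n) → Child T s s₁ →
    (z u : Fin n) → z ∈ Sub T s₁ → u ∈ Sub T s₁ →
    IsLCA T z z u → z ≢ u →
    s ∈ J G z u ⇔ (∃ λ t → t ∈ δ⁻ G u × s ∈ J G z t)
lemma3 n G acyclic s T s₁ s→s₁ z u z∈ u∈ lca z≢u =
  mk⇔ (junction⇒parent-junction G acyclic (Sub-child⇒≢ acyclic T s→s₁ z∈)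
                                          (Sub-child⇒≢ acyclic T s→s₁ u∈))
      (λ (t , t→u , s∈J) → parent-junction⇒junction G acyclic z≢u z→*u t→u s∈J)
  where
  z→*u : Star (Arc G) z u
  z→*u = let (_ , _ , z↝u) = IsLCA.ancestorʳ lca in map (Child⇒Arc T) z↝u
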